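{- Let $n$ be a number of worlds. For every modal formula $\varphi$ and every model $\mathcal{M}=(W,R,V)$ on $W=\{0,\dots,n-1\}$, the integer computed for $\varphi$ by the bitmask recurrence equals $\widehat{[\![\varphi]\!]^{\mathcal{M}}}$, the encoding of the truth set of $\varphi$ in $\mathcal{M}$. Hence, for a frame $\mathcal{F}=(W,R)$ on $n$ worlds, $\mathcal{F}\models\varphi$ if and only if the computed integer is $\mathit{full}=2^n-1$ under every valuation $V$; and $(\mathcal{F},V,w)$ is a countermodel to $\varphi$ if and only if bit $w$ of the integer computed for $\varphi$ on $(\mathcal{F},V)$ is $0$.
   Context: Modal formulas over variables $p_0,p_1,\dots$ are generated by $\varphi ::= \top\mid\bot\mid p_i\mid\neg\varphi\mid\varphi\wedge\varphi\mid\varphi\vee\varphi\mid\varphi\rightarrow\varphi\mid\Box\varphi\mid\Diamond\varphi$. A frame is $\mathcal{F}=(W,R)$ with $W$ finite and $R\subseteq W^2$; a model $\mathcal{M}=(W,R,V)$ adds a valuation $V$ assigning to each variable a subset of $W$. Satisfaction $\mathcal{M},w\Vdash\varphi$ is standard Kripke satisfaction: $\mathcal{M},w\Vdash\Box\varphi$ iff $\mathcal{M},v\Vdash\varphi$ for all $v$ with $R(w,v)$, and $\mathcal{M},w\Vdash\Diamond\varphi$ iff $\mathcal{M},v\Vdash\varphi$ for some $v$ with $R(w,v)$. The truth set is $[\![\varphi]\!]^{\mathcal{M}}=\{w\in W:\mathcal{M},w\Vdash\varphi\}$. $\mathcal{F}\models\varphi$ means $[\![\varphi]\!]^{(\mathcal{F},V)}=W$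 for every valuation $V$. A countermodel to $\varphi$ is a triple $(\mathcal{F},V,w)$ such that $\varphi$ is false at $w$ in $(\mathcal{F},V)$. Bitmask encoding. A subset $S\subseteq W=\{0,\dots,n-1\}$ is encoded as the integer $\widehat S=\sum_{w\in S}2^w$. Let $\mathit{full}=2^n-1$, let $\&$, $|$, $\sim$ denote bitwise AND, OR and NOT, and let $\overline{x}=\mathit{full}\mathbin{\&}(\sim x)$. A frame is represented by the successor masks $\mathrm{succ}[w]=\widehat{\{v:R(w,v)\}}$, and a valuation by one mask $\widehat{V(p_i)}$ per variable. Bitmask recurrence. It assigns to each formula $\varphi$ an integer $m(\varphi)$ by: $m(\top)=\mathit{full}$, $m(\bot)=0$, $m(p_i)=\widehat{V(p_i)}$, $m(\neg\varphi)=\overline{m(\varphi)}$, $m(\varphi\wedge\psi)=m(\varphi)\mathbin{\&}m(\psi)$, $m(\varphi\vee\psi)=m(\varphi)\mathbin{|}m(\psi)$, $m(\varphi\rightarrow\psi)=\overline{m(\varphi)}\mathbin{|}m(\psi)$; bit $w$ of $m(\Box\varphi)$ is $1$ iff $\mathrm{succ}[w]\mathbin{\&}\overline{m(\varphi)}=0$; bit $w$ of $m(\Diamond\varphi)$ is $1$ iff $\mathrm{succ}[w]\mathbin{\&}m(\varphi)\neq 0$ (for $0\le w<n$, all other bits being $0$). -}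

module Defs where

open import Data.Bool.Base using (Bool; not; _∧_; _∨_; if_then_else_)
open import Data.Empty using (⊥)
open import Data.Fin.Base using (Fin; toℕ)
open import Data.Fin.Properties using (all?; any?)
open import Data.Fin.Subset using (Subset; _∈_) renaming (⊤ to W)
open import Data.Fin.Subset.Properties using (_∈?_)
open import Data.Integer.Base using (ℤ; +_; -[1+_]; _-_; 0ℤ; 1ℤ; _/ℕ_; _%ℕ_)
import Data.Integer.Properties as ℤ
open import Data.Nat.Base using (ℕ; _^_; _⊔_; _≡ᵇ_)
open import Data.Nat.Properties using (m^n≢0; +-0-commutativeMonoid)
open import Data.Product.Base using (∃-syntax; _×_)
open import Data.Sum.Base using (_⊎_)
open import Data.Unit.Base using (⊤)
open import Data.Vec.Base using (lookup; tabulate)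
open import Level using (0ℓ)
open import Relation.Binary.Core using (Rel)
open import Relation.Binary.Definitions using (Decidable)
open import Relation.Binary.PropositionalEquality.Core using (_≡_)
open import Relation.Nullary.Decidable
  using (Dec; yes; no; does; ¬?; _×-dec_; _⊎-dec_; _→-dec_)
open import Relation.Nullary.Negation using (¬_)

open import Algebra.Properties.CommutativeMonoid.Sum +-0-commutativeMonoid
  using (sum-syntax)

infix  10 `¬_ □_ ◇_
infixr 9  _`∧_
infixr 8  _`∨_
infixr 7  _`→_

data Formula : Set where
  `⊤ `⊥          : Formula
  var            : ℕ → Formula
  `¬_            : Formula → Formula
  _`∧_ _`∨_ _`→_ : Formula → Formula → Formula
  □_ ◇_          : Formula → Formula

-- Subsets of a finite set are decidable classically.  Constructively this has
-- to be recorded: for R as a decision procedure, for V(pᵢ) by using `Subset`.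
record Frame (n : ℕ) : Set₁ where
  field
    R  : Rel (Fin n) 0ℓ
    R? : Decidable R

open Frame

Valuation : ℕ → Set
Valuation n = ℕ → Subset n

infix 4 _,_,_⊩_ _⊨_

_,_,_⊩_ : ∀ {n} → Frame n → Valuation n → Fin n → Formula → Set
F , V , w ⊩ `⊤     = ⊤
F , V , w ⊩ `⊥     = ⊥
F , V , w ⊩ var i  = w ∈ V i
F , V , w ⊩ `¬ φ   = ¬ (F , V , w ⊩ φ)
F , V , w ⊩ φ `∧ ψ = (F , V , w ⊩ φ) × (F , V , w ⊩ ψ)
F , V , w ⊩ φ `∨ ψ = (F , V , w ⊩ φ) ⊎ (F , V , w ⊩ ψ)
F , V , w ⊩ φ `→ ψ = (F , V , w ⊩ φ) → (F , V , w ⊩ ψ)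
F , V , w ⊩ □ φ    = ∀ v → R F w v → F , V , v ⊩ φ
F , V , w ⊩ ◇ φ    = ∃[ v ] R F w v × (F , V , v ⊩ φ)

sat? : ∀ {n} (F : Frame n) (V : Valuation n) w φ → Dec (F , V , w ⊩ φ)
sat? F V w `⊤       = yes _
sat? F V w `⊥       = no λ ()
sat? F V w (var i)  = w ∈? V i
sat? F V w (`¬ φ)   = ¬? (sat? F V w φ)
sat? F V w (φ `∧ ψ) = sat? F V w φ ×-dec sat? F V w ψ
sat? F V w (φ `∨ ψ) = sat? F V w φ ⊎-dec sat? F V w ψ
sat? F V w (φ `→ ψ) = sat? F V w φ →-dec sat? F V w ψ
sat? F V w (□ φ)    = all? λ v → R? F w v →-dec sat? F V v φ
sat? F V w (◇ φ)    = any? λ v → R? F w v ×-dec sat? F V v φ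

truthSet : ∀ {n} → Frame n → Valuation n → Formula → Subset n
truthSet F V φ = tabulate λ w → does (sat? F V w φ)

_⊨_ : ∀ {n} → Frame n → Formula → Set
F ⊨ φ = ∀ V → truthSet F V φ ≡ W

Countermodel : ∀ {n} → Frame n → Valuation n → Fin n → Formula → Set
Countermodel F V w φ = ¬ (F , V , w ⊩ φ)

fromBits : ∀ {n} → (Fin n → Bool) → ℕ
fromBits {n} b = ∑[ i < n ] (if b i then 2 ^ toℕ i else 0)

encode : ∀ {n} → Subset n → ℤ
encode S = + fromBits (lookup S)

-- Division rounds down, so on negative integers these are the two's-complement
-- bits.
bit : ℤ → ℕ → ℕ
bit x i = ((x /ℕ (2 ^ i)) {{m^n≢0 2 i}}) %ℕ 2

-- Bits at positions ≥ x ⊔ y of x and of y are 0, so nothing is cut off as long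
-- as f false false = false.
bitwise : (Bool → Bool → Bool) → ℕ → ℕ → ℕ
bitwise f x y = fromBits {x ⊔ y} λ i →
  f (bit (+ x) (toℕ i) ≡ᵇ 1) (bit (+ y) (toℕ i) ≡ᵇ 1)

-- Bitwise operations on integers in two's complement with infinite sign
-- extension: -[1+ x ] is the bitwise NOT of + x, and the other clauses follow
-- from the De Morgan laws.
infix  8  ~_
infixl 7  _&_
infixl 6  _∣_

~_ : ℤ → ℤ
~ (+ x)    = -[1+ x ]
~ -[1+ x ] = + x

_&_ : ℤ → ℤ → ℤ
+ x      & + y      = + bitwise _∧_ x y
+ x      & -[1+ y ] = + bitwise (λ a b → a ∧ not b) x y
-[1+ x ] & + y      = + bitwise (λ a b → not a ∧ b) x y
-[1+ x ] & -[1+ y ] = -[1+ bitwise _∨_ x y ]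

_∣_ : ℤ → ℤ → ℤ
+ x      ∣ + y      = + bitwise _∨_ x y
+ x      ∣ -[1+ y ] = -[1+ bitwise (λ a b → not a ∧ b) x y ]
-[1+ x ] ∣ + y      = -[1+ bitwise (λ a b → a ∧ not b) x y ]
-[1+ x ] ∣ -[1+ y ] = -[1+ bitwise _∧_ x y ]

full : ℕ → ℤ
full n = + (2 ^ n) - 1ℤ

comp : ℕ → ℤ → ℤ
comp n x = full n & (~ x)

succMask : ∀ {n} → Frame n → Fin n → ℤ
succMask F w = encode (tabulate λ v → does (R? F w v))

recurrence : ∀ {n} → (Fin n → ℤ) → (ℕ → ℤ) → Formula → ℤ
recurrence {n} succ val = m
  where
  m : Formula → ℤ
  m `⊤       = full n
  m `⊥       = 0ℤ
  m (var i)  = val i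
  m (`¬ φ)   = comp n (m φ)
  m (φ `∧ ψ) = m φ & m ψ
  m (φ `∨ ψ) = m φ ∣ m ψ
  m (φ `→ ψ) = comp n (m φ) ∣ m ψ
  m (□ φ)    = + fromBits {n} λ w → does (succ w & comp n (m φ) ℤ.≟ 0ℤ)
  m (◇ φ)    = + fromBits {n} λ w → not (does (succ w & m φ ℤ.≟ 0ℤ))

computed : ∀ {n} → Frame n → Valuation n → Formula → ℤ
computed F V = recurrence (succMask F) (λ i → encode (V i))

{-# OPTIONS --safe #-}

-- Bit i of fromBits b is b i, and bits beyond the length of b are 0, so an
-- integer operation that acts bit by bit with f (false , false) = false sends
-- encodings to encodings, whatever number of bits it inspects.  The claim then
-- follows by induction on φ; in the modal cases the mask of successors violating
-- (satisfying) φ is 0 iff there is no such successor.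
module Submission where

open import Defs
open import Algebra.Properties.CommutativeMonoid.Sum using (sum-cong-≗)
open import Algebra.Properties.Semiring.Sum using (*-distribˡ-sum)
open import Data.Bool.Base
  using (Bool; true; false; not; _∧_; _∨_; if_then_else_)
open import Data.Fin.Base using (Fin; zero; suc; toℕ)
open import Data.Fin.Subset using (Subset) renaming (⊤ to W)
open import Data.Fin.Subset.Properties using (_∈?_)
open import Data.Integer.Base using (+_; _-_; 0ℤ; 1ℤ)
import Data.Integer.Properties as ℤ
open import Data.Nat.Base
open import Data.Nat.Divisibility using (m∣m*n)
open import Data.Nat.DivMod
open import Data.Nat.Properties
open import Data.Product.Base using (_×_; _,_)
open import Data.Vec.Base using (_∷_; lookup; tabulate)
open import Data.Vec.Properties
  using (lookup∘tabulate; tabulate∘lookup; tabulate-cong; lookup-replicate)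
open import Function.Base using (_∘_; const)
open import Function.Bundles using (_⇔_; mk⇔; Equivalence)
open import Relation.Binary.PropositionalEquality
open import Relation.Nullary.Decidable
  using (Dec; yes; no; does; ¬?; _×-dec_; dec-true; dec-false; does-⇔; decidable-stable)
open import Relation.Nullary.Negation using (¬_; contradiction)

open Frame

private
  variable
    n : ℕ

-- Binary digits of sums of powers of two.

digit : Bool → ℕ
digit c = if c then 1 else 0

digit-injective : ∀ {c d} → digit c ≡ digit d → c ≡ d
digit-injective {false} {false} _ = refl
digit-injective {true}  {true}  _ = refl

digit≤1 : ∀ c → digit c ≤ 1
digit≤1 false = z≤n
digit≤1 true  = ≤-refl

digit≡ᵇ1 : ∀ c → (digit c ≡ᵇ 1) ≡ c
digit≡ᵇ1 false = refl
digit≡ᵇ1 true  = refl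

fromBits-cong : {a b : Fin n → Bool} → a ≗ b → fromBits a ≡ fromBits b
fromBits-cong a≗b = sum-cong-≗ +-0-commutativeMonoid
  λ i → cong (λ c → if c then 2 ^ toℕ i else 0) (a≗b i)

-- Horner's rule: every weight after the first contains a factor 2. This drives the inductions that
-- peel off the lowest bit.
fromBits-suc : (b : Fin (suc n) → Bool) →
               fromBits b ≡ digit (b zero) + 2 * fromBits (b ∘ suc)
fromBits-suc b = cong (λ x → digit (b zero) + x) (sym (trans
  (*-distribˡ-sum +-*-semiring 2 λ i → if b (suc i) then 2 ^ toℕ i else 0)
  (sum-cong-≗ +-0-commutativeMonoid λ i → double (b (suc i)) (2 ^ toℕ i))))
  where
  double : ∀ c x → 2 * (if c then x else 0) ≡ (if c then 2 * x else 0)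
  double false x = refl
  double true  x = refl

fromBits<2^n : (b : Fin n → Bool) → fromBits b < 2 ^ n
fromBits<2^n {zero}  b = ≤-refl
fromBits<2^n {suc n} b = begin
  suc (fromBits b)                              ≡⟨ cong suc (fromBits-suc b) ⟩
  suc (digit (b zero) + 2 * fromBits (b ∘ suc)) ≤⟨ s≤s (+-monoˡ-≤ _ (digit≤1 (b zero))) ⟩
  2 + 2 * fromBits (b ∘ suc)                    ≡⟨ *-suc 2 _ ⟨
  2 * suc (fromBits (b ∘ suc))                  ≤⟨ *-monoʳ-≤ 2 (fromBits<2^n (b ∘ suc)) ⟩
  2 ^ suc n                                     ∎
  where open ≤-Reasoning

fromBits-false : ∀ n → fromBits {n} (const false) ≡ 0
fromBits-false zero    = refl
fromBits-false (suc n) = fromBits-false n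

-- The `suc` avoids truncated subtraction on `ℕ`; it cancels later because `+ suc k - 1ℤ` computes
-- to `+ k`.
fromBits-true : ∀ n → suc (fromBits {n} (const true)) ≡ 2 ^ n
fromBits-true zero    = refl
fromBits-true (suc n) = begin
  suc (fromBits {suc n} (const true))   ≡⟨ cong suc (fromBits-suc {n} (const true)) ⟩
  2 + 2 * fromBits {n} (const true)     ≡⟨ *-suc 2 _ ⟨
  2 * suc (fromBits {n} (const true))   ≡⟨ cong (2 *_) (fromBits-true n) ⟩
  2 ^ suc n                             ∎
  where open ≡-Reasoning

bit-suc : ∀ x i → bit (+ x) (suc i) ≡ bit (+ (x / 2)) i
bit-suc x i = cong (_% 2)
  (sym (m/n/o≡m/[n*o] x 2 (2 ^ i) {{_}} {{m^n≢0 2 i}} {{m^n≢0 2 (suc i)}}))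

[digit+2*m]%2 : ∀ c m → (digit c + 2 * m) % 2 ≡ digit c
[digit+2*m]%2 c m = begin
  (digit c + 2 * m) % 2 ≡⟨ cong (λ x → (digit c + x) % 2) (*-comm 2 m) ⟩
  (digit c + m * 2) % 2 ≡⟨ [m+kn]%n≡m%n (digit c) m 2 ⟩
  digit c % 2           ≡⟨ m<n⇒m%n≡m (s≤s (digit≤1 c)) ⟩
  digit c               ∎
  where open ≡-Reasoning

[digit+2*m]/2 : ∀ c m → (digit c + 2 * m) / 2 ≡ m
[digit+2*m]/2 c m = begin
  (digit c + 2 * m) / 2     ≡⟨ +-distrib-/-∣ʳ (digit c) (m∣m*n m) ⟩
  digit c / 2 + 2 * m / 2   ≡⟨ cong₂ _+_ (m<n⇒m/n≡0 (s≤s (digit≤1 c))) (cong (_/ 2) (*-comm 2 m)) ⟩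
  m * 2 / 2                 ≡⟨ m*n/n≡m m 2 ⟩
  m                         ∎
  where open ≡-Reasoning

-- Induction on the position: in Horner's form the remainder modulo 2 is the lowest digit, and
-- halving drops that digit and shifts the others down by one.
bit-fromBits : (b : Fin n → Bool) (i : Fin n) →
               bit (+ fromBits b) (toℕ i) ≡ digit (b i)
bit-fromBits b zero = begin
  (fromBits b / 1) % 2                               ≡⟨ cong (_% 2) (n/1≡n (fromBits b)) ⟩
  fromBits b % 2                                     ≡⟨ cong (_% 2) (fromBits-suc b) ⟩
  (digit (b zero) + 2 * fromBits (b ∘ suc)) % 2      ≡⟨ [digit+2*m]%2 (b zero) (fromBits (b ∘ suc)) ⟩
  digit (b zero)                                     ∎
  where open ≡-Reasoning
bit-fromBits b (suc i) = begin
  bit (+ fromBits b) (suc (toℕ i))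
    ≡⟨ bit-suc (fromBits b) (toℕ i) ⟩
  bit (+ (fromBits b / 2)) (toℕ i)
    ≡⟨ cong (λ x → bit (+ (x / 2)) (toℕ i)) (fromBits-suc b) ⟩
  bit (+ ((digit (b zero) + 2 * fromBits (b ∘ suc)) / 2)) (toℕ i)
    ≡⟨ cong (λ x → bit (+ x) (toℕ i)) ([digit+2*m]/2 (b zero) (fromBits (b ∘ suc))) ⟩
  bit (+ fromBits (b ∘ suc)) (toℕ i)
    ≡⟨ bit-fromBits (b ∘ suc) i ⟩
  digit (b (suc i))
    ∎
  where open ≡-Reasoning

fromBits-injective : {a b : Fin n → Bool} → fromBits a ≡ fromBits b → a ≗ b
fromBits-injective {a = a} {b} eq i = digit-injective (begin
  digit (a i)                 ≡⟨ bit-fromBits a i ⟨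
  bit (+ fromBits a) (toℕ i)  ≡⟨ cong (λ x → bit (+ x) (toℕ i)) eq ⟩
  bit (+ fromBits b) (toℕ i)  ≡⟨ bit-fromBits b i ⟩
  digit (b i)                 ∎)
  where open ≡-Reasoning

-- Bitwise operations on encodings.

x<2^i⇒bit≡0 : ∀ {x i} → x < 2 ^ i → bit (+ x) i ≡ 0
x<2^i⇒bit≡0 {i = i} x<2^i = cong (_% 2) (m<n⇒m/n≡0 {{m^n≢0 2 i}} x<2^i)

n<2^n : ∀ n → n < 2 ^ n
n<2^n zero    = ≤-refl
n<2^n (suc n) = begin
  2 + n              ≤⟨ +-monoʳ-≤ 2 (m≤n*m n 2) ⟩
  2 + 2 * n          ≡⟨ *-suc 2 n ⟨
  2 * suc n          ≤⟨ *-monoʳ-≤ 2 (n<2^n n) ⟩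
  2 ^ suc n          ∎
  where open ≤-Reasoning

-- `bitwise` reads `x ⊔ y` positions, whereas an encoding has one per world, and either number can
-- be the larger. Both tails are therefore assumed false: the windows shrink together until one is
-- empty, and then the other holds only zeros.
fromBits-window : ∀ m n (g : ℕ → Bool) →
                  (∀ i → m ≤ i → g i ≡ false) → (∀ i → n ≤ i → g i ≡ false) →
                  fromBits {m} (g ∘ toℕ) ≡ fromBits {n} (g ∘ toℕ)
fromBits-window zero n g g≡false _ =
  sym (trans (fromBits-cong {n} λ i → g≡false (toℕ i) z≤n) (fromBits-false n))
fromBits-window (suc m) zero g _ g≡false =
  trans (fromBits-cong {suc m} λ i → g≡false (toℕ i) z≤n) (fromBits-false (suc m))
fromBits-window (suc m) (suc n) g gₘ gₙ = begin
  fromBits {suc m} (g ∘ toℕ)                       ≡⟨ fromBits-suc {m} (g ∘ toℕ) ⟩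
  digit (g 0) + 2 * fromBits {m} (g ∘ suc ∘ toℕ)   ≡⟨ cong (λ x → digit (g 0) + 2 * x) ih ⟩
  digit (g 0) + 2 * fromBits {n} (g ∘ suc ∘ toℕ)   ≡⟨ fromBits-suc {n} (g ∘ toℕ) ⟨
  fromBits {suc n} (g ∘ toℕ)                       ∎
  where
  open ≡-Reasoning
  ih = fromBits-window m n (g ∘ suc) (λ i → gₘ (suc i) ∘ s≤s) (λ i → gₙ (suc i) ∘ s≤s)

module _ (f : Bool → Bool → Bool) (f-false : f false false ≡ false) where

  bitwise-fromBits : (a b : Fin n → Bool) →
    bitwise f (fromBits a) (fromBits b) ≡ fromBits (λ i → f (a i) (b i))
  bitwise-fromBits {n} a b = trans
    (fromBits-window (x ⊔ y) n g
      -- Past the window of `bitwise`, `x < 2 ^ x ≤ 2 ^ i`, and likewise for `y`; past position `n`,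
      -- both numbers are below `2 ^ n`. Either way both bits vanish and `f-false` applies.
      (λ i x⊔y≤i → g≡false i
        (<-≤-trans (n<2^n x) (^-monoʳ-≤ 2 (≤-trans (m≤m⊔n x y) x⊔y≤i)))
        (<-≤-trans (n<2^n y) (^-monoʳ-≤ 2 (≤-trans (m≤n⊔m x y) x⊔y≤i))))
      (λ i n≤i → g≡false i
        (<-≤-trans (fromBits<2^n a) (^-monoʳ-≤ 2 n≤i))
        (<-≤-trans (fromBits<2^n b) (^-monoʳ-≤ 2 n≤i))))
    (fromBits-cong λ i → cong₂ f (testBit a i) (testBit b i))
    where
    x y : ℕ
    x = fromBits a
    y = fromBits b

    g : ℕ → Bool
    g i = f (bit (+ x) i ≡ᵇ 1) (bit (+ y) i ≡ᵇ 1)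

    g≡false : ∀ i → x < 2 ^ i → y < 2 ^ i → g i ≡ false
    g≡false i x< y< = trans
      (cong₂ f (cong (_≡ᵇ 1) (x<2^i⇒bit≡0 {i = i} x<))
               (cong (_≡ᵇ 1) (x<2^i⇒bit≡0 {i = i} y<)))
      f-false

    testBit : (c : Fin n → Bool) → ∀ i → (bit (+ fromBits c) (toℕ i) ≡ᵇ 1) ≡ c i
    testBit c i = trans (cong (_≡ᵇ 1) (bit-fromBits c i)) (digit≡ᵇ1 (c i))

&-fromBits : (a b : Fin n → Bool) →
             + fromBits a & + fromBits b ≡ + fromBits (λ i → a i ∧ b i)
&-fromBits a b = cong +_ (bitwise-fromBits _∧_ refl a b)

∣-fromBits : (a b : Fin n → Bool) →
             + fromBits a ∣ + fromBits b ≡ + fromBits (λ i → a i ∨ b i)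
∣-fromBits a b = cong +_ (bitwise-fromBits _∨_ refl a b)

full≡fromBits : ∀ n → full n ≡ + fromBits {n} (const true)
full≡fromBits n = cong (λ x → + x - 1ℤ) (sym (fromBits-true n))

-- The negative number `~ (+ x)` is `-[1+ x ]`, so `&` takes its mixed clause, whose operation
-- `c ∧ not d` still sends two zeros to zero.
comp-fromBits : (b : Fin n → Bool) → comp n (+ fromBits b) ≡ + fromBits (not ∘ b)
comp-fromBits {n} b = trans
  (cong (_& (~ (+ fromBits b))) (full≡fromBits n))
  (cong +_ (bitwise-fromBits (λ c d → c ∧ not d) refl (const true) b))

-- Zero is the encoding of the constantly false function, so injectivity reduces the test of a mask
-- against zero to its single bits.
+fromBits≡0⇔ : {P : Fin n → Set} (P? : ∀ i → Dec (P i)) →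
               (+ fromBits (does ∘ P?) ≡ 0ℤ) ⇔ (∀ i → ¬ P i)
+fromBits≡0⇔ {n} P? = mk⇔
  (λ eq i p → contradiction
    (trans (sym (dec-true (P? i) p))
      (fromBits-injective (trans (ℤ.+-injective eq) (sym (fromBits-false n))) i))
    λ ())
  (λ ¬p → cong +_ (trans (fromBits-cong λ i → dec-false (P? i) (¬p i)) (fromBits-false n)))

-- Encoded subsets.

does-∈? : (S : Subset n) (i : Fin n) → does (i ∈? S) ≡ lookup S i
does-∈? (true  ∷ S) zero    = refl
does-∈? (false ∷ S) zero    = refl
does-∈? (_     ∷ S) (suc i) = does-∈? S i

encode-injective : {S T : Subset n} → encode S ≡ encode T → S ≡ T
encode-injective {S = S} {T} eq = begin
  S                    ≡⟨ tabulate∘lookup S ⟨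
  tabulate (lookup S)  ≡⟨ tabulate-cong (fromBits-injective (ℤ.+-injective eq)) ⟩
  tabulate (lookup T)  ≡⟨ tabulate∘lookup T ⟩
  T                    ∎
  where open ≡-Reasoning

encode-tabulate : (b : Fin n → Bool) → encode (tabulate b) ≡ + fromBits b
encode-tabulate b = cong +_ (fromBits-cong (lookup∘tabulate b))

encode-W : ∀ n → encode (W {n}) ≡ full n
encode-W n = trans
  (cong +_ (fromBits-cong {n} λ i → lookup-replicate i true))
  (sym (full≡fromBits n))

-- Induction on formulas.

module _ (F : Frame n) (V : Valuation n) where

  private
    truth : Formula → Fin n → Bool
    truth φ w = does (sat? F V w φ)

  -- With Boolean functions in place of subsets, the connective cases close by computation: `does`
  -- turns `¬?`, `×-dec`, `⊎-dec` and `→-dec` into the Boolean operations that the masks perform.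
  computed≡fromBits : ∀ φ → computed F V φ ≡ + fromBits (truth φ)
  computed≡fromBits `⊤       = full≡fromBits n
  computed≡fromBits `⊥       = cong +_ (sym (fromBits-false n))
  computed≡fromBits (var i)  = cong +_ (fromBits-cong λ w → sym (does-∈? (V i) w))
  computed≡fromBits (`¬ φ)   = trans
    (cong (comp n) (computed≡fromBits φ)) (comp-fromBits (truth φ))
  computed≡fromBits (φ `∧ ψ) = trans
    (cong₂ _&_ (computed≡fromBits φ) (computed≡fromBits ψ)) (&-fromBits (truth φ) (truth ψ))
  computed≡fromBits (φ `∨ ψ) = trans
    (cong₂ _∣_ (computed≡fromBits φ) (computed≡fromBits ψ)) (∣-fromBits (truth φ) (truth ψ))
  computed≡fromBits (φ `→ ψ) = trans
    (cong₂ _∣_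
      (trans (cong (comp n) (computed≡fromBits φ)) (comp-fromBits (truth φ)))
      (computed≡fromBits ψ))
    (∣-fromBits (not ∘ truth φ) (truth ψ))
  computed≡fromBits (□ φ) = cong +_ (fromBits-cong λ w →
    does-⇔ (mk⇔
      -- A zero mask only excludes successors refuting `φ`; decidability of satisfaction turns this
      -- into truth of `φ` at each successor.
      (λ eq v wRv → decidable-stable (sat? F V v φ) λ ¬φ →
        to (noCounterexample w) (trans (sym (mask w)) eq) v (wRv , ¬φ))
      (λ □φ → trans (mask w) (from (noCounterexample w) λ v (wRv , ¬φ) → ¬φ (□φ v wRv))))
      (_ ℤ.≟ 0ℤ) (sat? F V w (□ φ)))
    where
    open Equivalence
    noCounterexample = λ w → +fromBits≡0⇔ λ v → R? F w v ×-dec ¬? (sat? F V v φ)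
    mask = λ w → trans
      (cong₂ _&_
        (encode-tabulate λ v → does (R? F w v))
        (trans (cong (comp n) (computed≡fromBits φ)) (comp-fromBits (truth φ))))
      (&-fromBits (λ v → does (R? F w v)) (not ∘ truth φ))
  computed≡fromBits (◇ φ) = cong +_ (fromBits-cong λ w →
    does-⇔ (mk⇔
      -- A nonzero mask yields no witness directly. If there were none, the mask would be zero, and
      -- decidability of `◇ φ` removes the double negation.
      (λ neq → decidable-stable (sat? F V w (◇ φ)) λ ¬◇φ →
        neq (trans (mask w) (from (noWitness w) λ v p → ¬◇φ (v , p))))
      (λ (v , p) eq → to (noWitness w) (trans (sym (mask w)) eq) v p))
      (¬? (_ ℤ.≟ 0ℤ)) (sat? F V w (◇ φ)))
    where
    open Equivalence
    noWitness = λ w → +fromBits≡0⇔ λ v → R? F w v ×-dec sat? F V v φ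
    mask = λ w → trans
      (cong₂ _&_ (encode-tabulate λ v → does (R? F w v)) (computed≡fromBits φ))
      (&-fromBits (λ v → does (R? F w v)) (truth φ))

  computed≡encode : ∀ φ → computed F V φ ≡ encode (truthSet F V φ)
  computed≡encode φ = trans (computed≡fromBits φ) (sym (encode-tabulate (truth φ)))

  bit-computed : ∀ φ w → bit (computed F V φ) (toℕ w) ≡ digit (truth φ w)
  bit-computed φ w = trans
    (cong (λ x → bit x (toℕ w)) (computed≡fromBits φ)) (bit-fromBits (truth φ) w)

digit≡0⇔ : {P : Set} (P? : Dec P) → (¬ P) ⇔ (digit (does P?) ≡ 0)
digit≡0⇔ (yes p) = mk⇔ (λ ¬p → contradiction p ¬p) λ ()
digit≡0⇔ (no ¬p) = mk⇔ (const refl) (const ¬p)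

theorem1 : ∀ (n : ℕ) (φ : Formula) →
    (∀ (F : Frame n) (V : Valuation n) → computed F V φ ≡ encode (truthSet F V φ))
    × (∀ (F : Frame n) → (F ⊨ φ) ⇔ (∀ (V : Valuation n) → computed F V φ ≡ full n))
    × (∀ (F : Frame n) (V : Valuation n) (w : Fin n) →
    Countermodel F V w φ ⇔ (bit (computed F V φ) (toℕ w) ≡ 0))
theorem1 n φ =
    (λ F V → computed≡encode F V φ)
  , (λ F → mk⇔
      (λ F⊨φ V → trans (computed≡encode F V φ) (trans (cong encode (F⊨φ V)) (encode-W n)))
      -- Validity is an equality of subsets, so the equality of integers has to be decoded.
      (λ eq V → encode-injective
        (trans (sym (computed≡encode F V φ)) (trans (eq V) (sym (encode-W n))))))
  , λ F V w → subst (λ d → Countermodel F V w φ ⇔ (d ≡ 0))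
      (sym (bit-computed F V φ w)) (digit≡0⇔ (sat? F V w φ))
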